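{- $S_d(3,1)\ge 3.93\,d$; that is, every search algorithm for $3$ robots, at most $1$ of which is byzantine faulty, has competitive ratio at least $3.93$: for every search algorithm, $\sup_{d>0} S_d(3,1)/d\ge 3.93$.
   Context: Model. $n$ robots with distinct identities start at time $0$ at the origin of the real line and move along the line with speed at most $1$, changing direction or speed at no cost. A target lies at an unknown point at distance $d>0$ from the origin, i.e. at $d$ or $-d$, with $d$ unknown to the robots. At most $f$ robots are faulty; the bound $f$ is known, but not which robots are faulty. A search algorithm assigns each robot a trajectory, known to all robots; a robot's further motion may depend on the messages broadcast so far (computation and communication take no time). A robot detects whether the target is at a point only by being there. The only messages are announcements "the target is here", heard instantly by all robots at any distance; each message automatically carries the true identity and true current location of its sender. A robot visiting a point silently is taken to claim that the target is not there. Reliable (non-faulty) robots follow the algorithm and report truthfully. Faulty robots are controlled by an adversary: they may stay silent at the target or announce the target where it is not; a faulty robot that broadcasts while off its assigned trajectory is thereby detected as faulty. The search is completed at the first time when some reliable robot has visited the target and announced it and all reliable robots can be certain of its location (every scenario with at most $f$ faulty robots consistent with the messages so far has the target at that location). For an algorithm, the search time $S_d(n,f)$ is the worst-case completion time over both positions $\pm d$ of the target, all choices of at most $f$ faulty robots, and all behaviours of the faulty robots. The competitive ratio of an algorithm is $S_d(n,f)/d$, in the worst case over the unknown distance $d$. -}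

module Defs where

open import Level using (0ℓ)
open import Algebra.Bundles using (CommutativeRing)
import Algebra.Definitions.RawMonoid as RawMonoidMult
open import Data.Fin using (Fin)
open import Data.Fin.Subset using (Subset; ∣_∣; _∉_)
open import Data.Nat as ℕ using (ℕ)
open import Data.Product using (_×_; ∃; ∃-syntax)
open import Data.Sum using (_⊎_)
open import Function.Bundles using (_⇔_)
open import Relation.Binary.Core using (Rel)
open import Relation.Binary.Structures using (IsDecTotalOrder)
import Relation.Binary.Construct.NonStrictToStrict as ToStrict
open import Relation.Nullary using (¬_)

-- The real numbers, characterised as usual (up to unique isomorphism) as the
-- Dedekind-complete ordered field.  The order is decidable and every bounded
-- inhabited predicate has a supremum, so this is the classical real line.
record Reals : Set₁ where
  infix 4 _≤_ _<_
  infix 8 _⁻¹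
  field
    commutativeRing : CommutativeRing 0ℓ 0ℓ

  open CommutativeRing commutativeRing public
    renaming (Carrier to ℝ)

  field
    _≤_             : Rel ℝ 0ℓ
    isDecTotalOrder : IsDecTotalOrder _≈_ _≤_
    -- 0# ⁻¹ is left unspecified
    _⁻¹             : ℝ → ℝ
    ⁻¹-inverse      : ∀ x → ¬ x ≈ 0# → x * x ⁻¹ ≈ 1#
    1≉0             : ¬ 1# ≈ 0#
    +-monoˡ-≤       : ∀ {x y} z → x ≤ y → x + z ≤ y + z
    *-nonNegative   : ∀ {x y} → 0# ≤ x → 0# ≤ y → 0# ≤ x * y

  UpperBound : (ℝ → Set) → ℝ → Set
  UpperBound P b = ∀ x → P x → x ≤ b

  field
    complete : (P : ℝ → Set) → ∃ P → ∃ (UpperBound P) →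
               ∃[ s ] (UpperBound P s × (∀ b → UpperBound P b → s ≤ b))

  _<_ : Rel ℝ 0ℓ
  _<_ = ToStrict._<_ _≈_ _≤_

  fromℕ : ℕ → ℝ
  fromℕ k = RawMonoidMult._×_ +-rawMonoid k 1#

module Search (R : Reals) where
  open Reals R

  Robot : ℕ → Set
  Robot n = Fin n

  -- Motion along the line as a function of time.  Only times t ≥ 0 matter, and
  -- speed at most 1 means that the motion is 1-Lipschitz.
  record IsTrajectory (X : ℝ → ℝ) : Set where
    field
      start : X 0# ≈ 0#
      speed : ∀ s t → 0# ≤ s → s ≤ t → X t - X s ≤ t - s × X s - X t ≤ t - s

  FirstVisit : (ℝ → ℝ) → ℝ → ℝ → Set
  FirstVisit X x t = 0# ≤ t × X t ≈ x × (∀ s → 0# ≤ s → s < t → ¬ X s ≈ x)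

  -- A record of all broadcasts: announces i t p says that at time t robot i
  -- broadcasts "the target is here", with p the location attached to the message.
  record Log (n : ℕ) : Set₁ where
    field
      announces      : Robot n → ℝ → ℝ → Set
      announces-cong : ∀ {i t t′ p p′} → t ≈ t′ → p ≈ p′ →
                       announces i t p → announces i t′ p′

  open Log public

  AgreeBefore : ∀ {n} → ℝ → Log n → Log n → Set
  AgreeBefore T M M′ =
    ∀ i t p → t < T → announces M i t p ⇔ announces M′ i t p

  AgreeUpTo : ∀ {n} → ℝ → Log n → Log n → Set
  AgreeUpTo T M M′ =
    ∀ i t p → t ≤ T → announces M i t p ⇔ announces M′ i t p

  -- path M i is the trajectory assigned to robot i when the broadcasts are those
  -- in M.  Causality makes its value at time t depend only on the messages
  -- broadcast before t; by the speed bound, a message at time t itself could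
  -- not influence the position at time t anyway.
  record Algorithm (n : ℕ) : Set₁ where
    field
      path         : Log n → Robot n → ℝ → ℝ
      isTrajectory : ∀ M i → IsTrajectory (path M i)
      causal       : ∀ M M′ t → 0# ≤ t → AgreeBefore t M M′ →
                     ∀ i → path M i t ≈ path M′ i t

  open Algorithm public

  -- A complete run of the algorithm with at most f faulty robots.  A reliable
  -- robot announces the target once, when it first reaches it (announcing again
  -- at later visits would carry no information); faulty robots move and announce
  -- arbitrarily, except that every message carries its sender's true location.
  record Scenario {n : ℕ} (A : Algorithm n) (f : ℕ) : Set₁ where
    field
      target     : ℝ
      target≉0   : ¬ target ≈ 0#
      faulty     : Subset n
      fewFaulty  : ∣ faulty ∣ ℕ.≤ f
      position   : Robot n → ℝ → ℝ
      moves      : ∀ i → IsTrajectory (position i)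
      log        : Log n
      located    : ∀ i t p → announces log i t p → 0# ≤ t × p ≈ position i t
      obedient   : ∀ i → i ∉ faulty → ∀ t → 0# ≤ t →
                   position i t ≈ path A log i t
      truthful   : ∀ i → i ∉ faulty → ∀ t p →
                   announces log i t p ⇔
                   (p ≈ target × FirstVisit (position i) target t)

  open Scenario public

  CertainAt : ∀ {n f} {A : Algorithm n} → Scenario A f → ℝ → Set₁
  CertainAt {n} {f} {A} σ T =
    (σ′ : Scenario A f) → AgreeUpTo T (log σ) (log σ′) → target σ′ ≈ target σ

  -- Monotone in T, so this says that the completion time of σ is at most T.
  CompletedBy : ∀ {n f} {A : Algorithm n} → Scenario A f → ℝ → Set₁
  CompletedBy σ T =
    (∃[ i ] (i ∉ faulty σ × ∃[ t ] (t ≤ T × announces (log σ) i t (target σ))))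
    × CertainAt σ T

  -- S_d(n,f) ≤ s, where S_d(n,f) ∈ [0,∞] is the supremum of completion times.
  SearchTime≤ : ∀ {n} → Algorithm n → (f : ℕ) → (d s : ℝ) → Set₁
  SearchTime≤ A f d s =
    (σ : Scenario A f) → (target σ ≈ d) ⊎ (target σ ≈ - d) → CompletedBy σ s

  -- c is an upper bound of { S_d(n,f) / d : d > 0 }.
  SearchRatio≤ : ∀ {n} → Algorithm n → (f : ℕ) → ℝ → Set₁
  SearchRatio≤ A f c = ∀ d → 0# < d → SearchTime≤ A f d (c * d)

  -- The supremum of S_d(n,f) / d over d > 0, taken in [0,∞], is at least r:
  -- all its upper bounds are.
  CompetitiveRatio≥ : ∀ {n} → Algorithm n → (f : ℕ) → ℝ → Set₁
  CompetitiveRatio≥ A f r = ∀ c → SearchRatio≤ A f c → r ≤ c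

{-# OPTIONS --safe #-}
module Submission where

-- Put α = 3.93. A faulty robot may stay silent for ever, and until some reliable robot
-- reaches the target the run is the one without announcements. Hence if the ratio is
-- below α, in that run every point x is visited by two robots by time α|x|, and since there
-- are only three robots, one of them visits both x and -x by time α|x|: it covers x > 0.
--
-- A robot covering both x and y satisfies y ≤ (α-1)/2 x or y ≥ 2/(α-3) x. Indeed, let its
-- first visit to ±y be at y, at time b. If it visits -x after b, then it does so no earlier
-- than 2y + x; if before, then b ≥ 2x + y and it reaches -y no earlier than 3y + 2x.
--
-- As ((α-1)/2)² < 2/(α-3), a robot cannot stop covering: beyond a last covered point it
-- would leave the other two a stretch of ratio 2/(α-3), of which each covers only a part
-- of ratio at most (α-1)/2. But then the robot covers everything above a covered point,
-- contradicting the gap. Integer multiples of 1849 = 43² serve as a discretisation.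
--
-- The conclusion is an inequality between reals and hence decidable, so that the whole
-- argument takes place under double negation.

open import Defs
open import Data.Empty using (⊥; ⊥-elim)
open import Data.Fin using (Fin; punchIn; punchOut)
open import Data.Fin.Properties using (pigeonhole; punchInᵢ≢i; punchIn-injective; punchIn-punchOut)
open import Data.Fin.Subset using (Subset; ∣_∣; _∉_; ⁅_⁆)
open import Data.Fin.Subset.Properties using (∣⁅x⁆∣≡1; x∉⁅y⁆⇒x≢y)
open import Data.Nat as ℕ using (ℕ; zero; suc; NonZero; z≤n; s≤s)
import Data.Nat.Properties as ℕₚ
open import Data.Fin.Patterns using (0F; 1F; 2F; 3F)
open import Data.Vec.Functional using ([]; _∷_)
open import Data.Nat.Tactic.RingSolver using (solve-∀)
open import Data.Product using (_×_; _,_; proj₁; proj₂; ∃₂; ∃-syntax)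
open import Data.Sum using (_⊎_; inj₁; inj₂; [_,_])
import Data.Sum as Sum
open import Function using (_∘_; id)
open import Function.Bundles using (mk⇔; Equivalence)
open import Relation.Binary.PropositionalEquality as ≡ using (_≡_; _≢_)
open import Relation.Binary.Bundles using (Poset)
open import Relation.Binary.Structures using (IsDecTotalOrder)
import Relation.Binary.Construct.NonStrictToStrict as ToStrict
import Relation.Binary.Reasoning.PartialOrder as PosetReasoning
open import Relation.Nullary using (¬_; yes; no)
open import Relation.Nullary.Decidable using (False; toWitnessFalse)
import Algebra.Properties.Group as GroupProperties
import Algebra.Properties.Semiring.Mult as SemiringMult
import Algebra.Properties.Ring as RingProperties

-- Gap inequalities on naturals and a pigeonhole principle.

-- y ≤ (α-1)/2 x or y ≥ 2/(α-3) x, for α = 3.93.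
Gap : ℕ → ℕ → Set
Gap x y = 200 ℕ.* y ℕ.≤ 293 ℕ.* x ⊎ 200 ℕ.* x ℕ.≤ 93 ℕ.* y

-- Each alternative is weakened to an extreme value of `n/m`, namely 1 for the first and `t/s` for
-- the second. Then `n` cancels, leaving two closed inequalities that computation refutes in the
-- implicit `False` arguments.
gap-fails : ∀ u v s t {m n} → m ℕ.≤ n → s ℕ.* n ℕ.≤ t ℕ.* m → .{{NonZero n}} →
            {False (200 ℕ.* v ℕₚ.≤? 293 ℕ.* u)} →
            {False (200 ℕ.* u ℕ.* s ℕₚ.≤? 93 ℕ.* v ℕ.* t)} →
            ¬ Gap (u ℕ.* m) (v ℕ.* n)
gap-fails u v s t {m} {n} m≤n _ {f} (inj₁ h) = toWitnessFalse f (ℕₚ.*-cancelʳ-≤ _ _ n (begin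
  200 ℕ.* v ℕ.* n      ≡⟨ ℕₚ.*-assoc 200 v n ⟩
  200 ℕ.* (v ℕ.* n)    ≤⟨ h ⟩
  293 ℕ.* (u ℕ.* m)    ≡⟨ ℕₚ.*-assoc 293 u m ⟨
  293 ℕ.* u ℕ.* m      ≤⟨ ℕₚ.*-monoʳ-≤ (293 ℕ.* u) m≤n ⟩
  293 ℕ.* u ℕ.* n      ∎))
  where open ℕₚ.≤-Reasoning
gap-fails u v s t {m} {n} _ sn≤tm {_} {f} (inj₂ h) = toWitnessFalse f (ℕₚ.*-cancelʳ-≤ _ _ n (begin
  200 ℕ.* u ℕ.* s ℕ.* n      ≡⟨ ℕₚ.*-assoc (200 ℕ.* u) s n ⟩
  200 ℕ.* u ℕ.* (s ℕ.* n)    ≤⟨ ℕₚ.*-monoʳ-≤ (200 ℕ.* u) sn≤tm ⟩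
  200 ℕ.* u ℕ.* (t ℕ.* m)    ≡⟨ swap 200 u t m ⟩
  200 ℕ.* (u ℕ.* m) ℕ.* t    ≤⟨ ℕₚ.*-monoˡ-≤ t h ⟩
  93 ℕ.* (v ℕ.* n) ℕ.* t     ≡⟨ swap′ 93 v n t ⟩
  93 ℕ.* v ℕ.* t ℕ.* n       ∎))
  where
  open ℕₚ.≤-Reasoning
  swap : ∀ a b c d → a ℕ.* b ℕ.* (c ℕ.* d) ≡ a ℕ.* (b ℕ.* d) ℕ.* c
  swap = solve-∀
  swap′ : ∀ a b c d → a ℕ.* (b ℕ.* c) ℕ.* d ≡ a ℕ.* b ℕ.* d ℕ.* c
  swap′ = solve-∀

no-four-distinct : ∀ {a b c d : Fin 3} → a ≢ b → a ≢ c → a ≢ d → b ≢ c → b ≢ d → c ≢ d → ⊥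
no-four-distinct {a} {b} {c} {d} ab ac ad bc bd cd
  with pigeonhole ℕₚ.≤-refl (a ∷ b ∷ c ∷ d ∷ [])
... | 0F , 0F , ()          , _
... | 0F , 1F , _           , a≡b = ab a≡b
... | 0F , 2F , _           , a≡c = ac a≡c
... | 0F , 3F , _           , a≡d = ad a≡d
... | 1F , 0F , ()          , _
... | 1F , 1F , s≤s ()      , _
... | 1F , 2F , _           , b≡c = bc b≡c
... | 1F , 3F , _           , b≡d = bd b≡d
... | 2F , 0F , ()          , _
... | 2F , 1F , s≤s ()      , _
... | 2F , 2F , s≤s (s≤s ()) , _
... | 2F , 3F , _           , c≡d = cd c≡d
... | 3F , 0F , ()          , _
... | 3F , 1F , s≤s ()      , _
... | 3F , 2F , s≤s (s≤s ()) , _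
... | 3F , 3F , s≤s (s≤s (s≤s ())) , _

-- Impossibility of a covering by three robots with gaps.

-- 63/43, the ratio of the progression 1849, 2709, 3969, exceeds 2.93/2, while its square
-- times 601/600 is below 2/0.93.
module Covering (C : Fin 3 → ℕ → Set)
                (gaps : ∀ i x y → C i x → C i y → Gap x y)
                (covered : ∀ m → .{{NonZero m}} → ¬ ¬ (∃[ i ] C i m)) where

  separate : ∀ {i j x y} → ¬ Gap x y → C i x → C j y → i ≢ j
  separate ¬gap cx cy ≡.refl = ¬gap (gaps _ _ _ cx cy)

  -- Otherwise the robots covering 1849n, 2709n and 3969n would differ from `i` and from each other,
  -- four in all. Since `m` is at least 600, `n/m` is at most 601/600, so the gap also fails when
  -- measured from 1849m.
  covers-next : ∀ i m → 600 ℕ.≤ m → C i (1849 ℕ.* m) → ¬ ¬ C i (1849 ℕ.* suc m)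
  covers-next i m 600≤m c₀ ¬c₁ =
    covered (1849 ℕ.* n) {{ℕₚ.m*n≢0 1849 n}} λ (_ , c₁) →
    covered (2709 ℕ.* n) {{ℕₚ.m*n≢0 2709 n}} λ (_ , c₂) →
    covered (3969 ℕ.* n) {{ℕₚ.m*n≢0 3969 n}} λ (_ , c₃) →
    no-four-distinct
      (λ { ≡.refl → ¬c₁ c₁ })
      (separate (gap-fails 1849 2709 600 601 m≤n 600n≤601m) c₀ c₂)
      (separate (gap-fails 1849 3969 600 601 m≤n 600n≤601m) c₀ c₃)
      (separate (gap-fails 1849 2709 1 1 ℕₚ.≤-refl ℕₚ.≤-refl) c₁ c₂)
      (separate (gap-fails 1849 3969 1 1 ℕₚ.≤-refl ℕₚ.≤-refl) c₁ c₃)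
      (separate (gap-fails 2709 3969 1 1 ℕₚ.≤-refl ℕₚ.≤-refl) c₂ c₃)
    where
    n = suc m
    m≤n : m ℕ.≤ n
    m≤n = ℕₚ.n≤1+n m
    600n≤601m : 600 ℕ.* n ℕ.≤ 601 ℕ.* m
    600n≤601m = ≡.subst (ℕ._≤ 601 ℕ.* m) (≡.sym (ℕₚ.*-suc 600 m)) (ℕₚ.+-monoˡ-≤ (600 ℕ.* m) 600≤m)

  covers-from-600 : ∀ i → C i (1849 ℕ.* 600) → ∀ k → ¬ ¬ C i (1849 ℕ.* (k ℕ.+ 600))
  covers-from-600 i c zero    ¬c = ¬c c
  covers-from-600 i c (suc k) ¬c = covers-from-600 i c k λ cₖ →
    covers-next i (k ℕ.+ 600) (ℕₚ.m≤n+m 600 k) cₖ ¬c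

  impossible : ⊥
  -- 880 = 280 + 600 is the least number whose ratio to 600 exceeds 293/200; 879 gives equality.
  impossible = covered (1849 ℕ.* 600) λ (i , c) → covers-from-600 i c 280 λ c′ →
    gap-fails (1849 ℕ.* 600) (1849 ℕ.* 880) 1 1 {1} {1} ℕₚ.≤-refl ℕₚ.≤-refl (gaps i _ _ c c′)

-- Ordered field arithmetic and the embedding of the naturals.

module OrderedField (R : Reals) where
  open Reals R
  open IsDecTotalOrder isDecTotalOrder public
    using (antisym; total; ≤-respˡ-≈; ≤-respʳ-≈; _≤?_)
    renaming (trans to ≤-trans; reflexive to ≤-reflexive; refl to ≤-refl)
  open GroupProperties +-group using (//-rightDividesˡ; //-rightDividesʳ; ⁻¹-involutive; ε⁻¹≈ε)
  open SemiringMult semiring using (×-homo-+; ×1-homo-*)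
  open RingProperties ring using (-1*x≈-x)

  poset : Poset _ _ _
  poset = record { isPartialOrder = IsDecTotalOrder.isPartialOrder isDecTotalOrder }

  module ≤-Reasoning = PosetReasoning poset
  open ≤-Reasoning

  ≤-<-trans : ∀ {x y z} → x ≤ y → y < z → x < z
  ≤-<-trans = ToStrict.≤-<-trans _≈_ _≤_ ≤-trans antisym ≤-respˡ-≈

  <-≤-trans : ∀ {x y z} → x < y → y ≤ z → x < z
  <-≤-trans = ToStrict.<-≤-trans _≈_ _≤_ sym ≤-trans antisym ≤-respʳ-≈

  +-monoʳ-≤ : ∀ {x y} z → x ≤ y → z + x ≤ z + y
  +-monoʳ-≤ {x} {y} z x≤y = begin
    z + x ≈⟨ +-comm z x ⟩
    x + z ≤⟨ +-monoˡ-≤ z x≤y ⟩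
    y + z ≈⟨ +-comm y z ⟩
    z + y ∎

  +-cancelʳ-≤ : ∀ {x y} z → x + z ≤ y + z → x ≤ y
  +-cancelʳ-≤ {x} {y} z h = begin
    x           ≈⟨ //-rightDividesʳ z x ⟨
    x + z - z   ≤⟨ +-monoˡ-≤ (- z) h ⟩
    y + z - z   ≈⟨ //-rightDividesʳ z y ⟩
    y           ∎

  x≤y⇒0≤y-x : ∀ {x y} → x ≤ y → 0# ≤ y - x
  x≤y⇒0≤y-x {x} {y} x≤y = begin
    0#    ≈⟨ -‿inverseʳ x ⟨
    x - x ≤⟨ +-monoˡ-≤ (- x) x≤y ⟩
    y - x ∎

  *-monoʳ-≤ : ∀ {x y z} → 0# ≤ z → x ≤ y → x * z ≤ y * z
  *-monoʳ-≤ {x} {y} {z} 0≤z x≤y = begin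
    x * z                 ≈⟨ +-identityˡ (x * z) ⟨
    0# + x * z            ≤⟨ +-monoˡ-≤ (x * z) (*-nonNegative (x≤y⇒0≤y-x x≤y) 0≤z) ⟩
    (y - x) * z + x * z   ≈⟨ distribʳ z (y - x) x ⟨
    ((y - x) + x) * z     ≈⟨ *-congʳ (//-rightDividesˡ x y) ⟩
    y * z                 ∎

  0≤1 : 0# ≤ 1#
  0≤1 with total 0# 1#
  ... | inj₁ h = h
  ... | inj₂ 1≤0 = begin
    0#               ≤⟨ *-nonNegative 0≤-1 0≤-1 ⟩
    (- 1#) * (- 1#)  ≈⟨ -1*x≈-x (- 1#) ⟩
    - - 1#           ≈⟨ ⁻¹-involutive 1# ⟩
    1#               ∎
    where
    0≤-1 : 0# ≤ - 1#
    0≤-1 = ≤-respʳ-≈ (+-identityˡ (- 1#)) (x≤y⇒0≤y-x 1≤0)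

  fromℕ-+ : ∀ m n → fromℕ (m ℕ.+ n) ≈ fromℕ m + fromℕ n
  fromℕ-+ = ×-homo-+ 1#

  fromℕ-* : ∀ m n → fromℕ (m ℕ.* n) ≈ fromℕ m * fromℕ n
  fromℕ-* = ×1-homo-*

  0≤fromℕ : ∀ n → 0# ≤ fromℕ n
  0≤fromℕ zero    = ≤-refl
  0≤fromℕ (suc n) = begin
    0#            ≤⟨ 0≤fromℕ n ⟩
    fromℕ n       ≈⟨ +-identityˡ (fromℕ n) ⟨
    0# + fromℕ n  ≤⟨ +-monoˡ-≤ (fromℕ n) 0≤1 ⟩
    1# + fromℕ n  ∎

  fromℕ-suc≉0 : ∀ n → ¬ fromℕ (suc n) ≈ 0#
  fromℕ-suc≉0 n eq = 1≉0 (antisym 1≤0 0≤1)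
    where
    1≤0 : 1# ≤ 0#
    1≤0 = begin
      1#            ≈⟨ +-identityʳ 1# ⟨
      1# + 0#       ≤⟨ +-monoʳ-≤ 1# (0≤fromℕ n) ⟩
      fromℕ (suc n) ≈⟨ eq ⟩
      0#            ∎

  fromℕ-cancel-≤ : ∀ m n → fromℕ m ≤ fromℕ n → m ℕ.≤ n
  fromℕ-cancel-≤ zero    n       _ = z≤n
  fromℕ-cancel-≤ (suc m) zero    h = ⊥-elim (fromℕ-suc≉0 m (antisym h (0≤fromℕ (suc m))))
  fromℕ-cancel-≤ (suc m) (suc n) h = s≤s (fromℕ-cancel-≤ m n (+-cancelʳ-≤ 1#
    (begin
      fromℕ m + 1#  ≈⟨ +-comm (fromℕ m) 1# ⟩
      1# + fromℕ m  ≤⟨ h ⟩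
      1# + fromℕ n  ≈⟨ +-comm 1# (fromℕ n) ⟩
      fromℕ n + 1#  ∎)))

  fromℕ≉0 : ∀ n → .{{NonZero n}} → ¬ fromℕ n ≈ 0#
  fromℕ≉0 (suc n) = fromℕ-suc≉0 n

  ratio-cancel-≤ : ∀ p q .{{_ : NonZero q}} {k m} →
                   fromℕ k ≤ (fromℕ p * fromℕ q ⁻¹) * fromℕ m → q ℕ.* k ℕ.≤ p ℕ.* m
  ratio-cancel-≤ p q@(suc q′) {k} {m} h = fromℕ-cancel-≤ (q ℕ.* k) (p ℕ.* m) (begin
    fromℕ (q ℕ.* k)        ≈⟨ fromℕ-* q k ⟩
    Q * fromℕ k            ≈⟨ *-comm Q (fromℕ k) ⟩
    fromℕ k * Q            ≤⟨ *-monoʳ-≤ (0≤fromℕ q) h ⟩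
    ((P * Q ⁻¹) * M) * Q   ≈⟨ *-assoc (P * Q ⁻¹) M Q ⟩
    (P * Q ⁻¹) * (M * Q)   ≈⟨ *-congˡ (*-comm M Q) ⟩
    (P * Q ⁻¹) * (Q * M)   ≈⟨ *-assoc (P * Q ⁻¹) Q M ⟨
    ((P * Q ⁻¹) * Q) * M   ≈⟨ *-congʳ (*-assoc P (Q ⁻¹) Q) ⟩
    (P * (Q ⁻¹ * Q)) * M   ≈⟨ *-congʳ (*-congˡ (trans (*-comm (Q ⁻¹) Q)
                                                (⁻¹-inverse Q (fromℕ-suc≉0 q′)))) ⟩
    (P * 1#) * M           ≈⟨ *-congʳ (*-identityʳ P) ⟩
    P * M                  ≈⟨ fromℕ-* p m ⟨
    fromℕ (p ℕ.* m)        ∎)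
    where
    P Q M : ℝ
    P = fromℕ p
    Q = fromℕ q
    M = fromℕ m

  -x≈0⇒x≈0 : ∀ {x} → - x ≈ 0# → x ≈ 0#
  -x≈0⇒x≈0 {x} eq = trans (sym (⁻¹-involutive x)) (trans (-‿cong eq) ε⁻¹≈ε)

-- Travel times and the gap between points covered by one trajectory.

module Motion (R : Reals) where
  open Reals R
  open Search R
  open OrderedField R
  open GroupProperties +-group using (//-rightDividesˡ; ⁻¹-involutive; ε⁻¹≈ε; x≈y⇒x∙y⁻¹≈ε)
  open ≤-Reasoning hiding (start)
  open IsTrajectory

  private variable
    X Y : ℝ → ℝ
    x s t T T′ : ℝ

  VisitsBy : (ℝ → ℝ) → ℝ → ℝ → Set
  VisitsBy X x T = ∃[ t ] (0# ≤ t × t ≤ T × X t ≈ x)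

  VisitsBy-mono : T ≤ T′ → VisitsBy X x T → VisitsBy X x T′
  VisitsBy-mono T≤T′ (t , 0≤t , t≤T , Xt≈x) = t , 0≤t , ≤-trans t≤T T≤T′ , Xt≈x

  VisitsBy-agree : (∀ t → 0# ≤ t → t ≤ T → X t ≈ Y t) → VisitsBy X x T → VisitsBy Y x T
  VisitsBy-agree X≈Y (t , 0≤t , t≤T , Xt≈x) = t , 0≤t , t≤T , trans (sym (X≈Y t 0≤t t≤T)) Xt≈x

  FirstVisit⇒VisitsBy : FirstVisit X x t → VisitsBy X x t
  FirstVisit⇒VisitsBy {t = t} (0≤t , Xt≈x , _) = t , 0≤t , ≤-refl , Xt≈x

  FirstVisit-agree : (∀ s → 0# ≤ s → s ≤ t → X s ≈ Y s) → FirstVisit X x t → FirstVisit Y x t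
  FirstVisit-agree {t} X≈Y (0≤t , Xt≈x , first) =
    0≤t , trans (sym (X≈Y t 0≤t ≤-refl)) Xt≈x ,
    λ s 0≤s s<t Ys≈x → first s 0≤s s<t (trans (X≈Y s 0≤s (proj₁ s<t)) Ys≈x)

  -- Respect for `≈` is not part of being a trajectory; it follows from the speed bound on an
  -- interval of length zero.
  trajectory-cong : IsTrajectory X → 0# ≤ s → s ≈ t → X s ≈ X t
  trajectory-cong {X} {s} {t} trj 0≤s s≈t = antisym (diff≤0 (proj₂ sp)) (diff≤0 (proj₁ sp))
    where
    sp : X t - X s ≤ t - s × X s - X t ≤ t - s
    sp = speed trj s t 0≤s (≤-reflexive s≈t)
    diff≤0 : ∀ {a b} → a - b ≤ t - s → a ≤ b
    diff≤0 {a} {b} h = begin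
      a            ≈⟨ //-rightDividesˡ b a ⟨
      (a - b) + b  ≤⟨ +-monoˡ-≤ b h ⟩
      (t - s) + b  ≈⟨ +-congʳ (x≈y⇒x∙y⁻¹≈ε (sym s≈t)) ⟩
      0# + b       ≈⟨ +-identityˡ b ⟩
      b            ∎

  FirstVisit-cong : IsTrajectory X → s ≈ t → FirstVisit X x s → FirstVisit X x t
  FirstVisit-cong trj s≈t (0≤s , Xs≈x , first) =
    ≤-respʳ-≈ s≈t 0≤s , trans (sym (trajectory-cong trj 0≤s s≈t)) Xs≈x ,
    λ r 0≤r r<t → first r 0≤r (<-≤-trans r<t (≤-reflexive (sym s≈t)))

  reflect : IsTrajectory X → IsTrajectory (-_ ∘ X)
  reflect {X} trj = record
    { start = trans (-‿cong (start trj)) ε⁻¹≈ε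
    ; speed = λ s t 0≤s s≤t →
        ≤-respˡ-≈ (flip s t) (proj₂ (speed trj s t 0≤s s≤t)) ,
        ≤-respˡ-≈ (flip t s) (proj₁ (speed trj s t 0≤s s≤t))
    }
    where
    flip : ∀ s t → X s - X t ≈ - X t - (- X s)
    flip s t = trans (+-comm (X s) (- X t)) (+-congˡ (sym (⁻¹-involutive (X s))))

  -- Leg lengths stay natural numbers, so that a chain of legs ends in an inequality decided in `ℕ`;
  -- `k` = 0 gives a leg from the origin.
  travel : IsTrajectory X → ∀ {s t} k l → 0# ≤ s → s ≤ t →
           X s ≈ - fromℕ k → X t ≈ fromℕ l → s + fromℕ (l ℕ.+ k) ≤ t
  travel {X} trj {s} {t} k l 0≤s s≤t Xs Xt = begin
    s + fromℕ (l ℕ.+ k)        ≈⟨ +-comm s (fromℕ (l ℕ.+ k)) ⟩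
    fromℕ (l ℕ.+ k) + s        ≈⟨ +-congʳ (fromℕ-+ l k) ⟩
    (fromℕ l + fromℕ k) + s    ≈⟨ +-congʳ (+-cong Xt (trans (-‿cong Xs) (⁻¹-involutive (fromℕ k)))) ⟨
    (X t - X s) + s            ≤⟨ +-monoˡ-≤ s (proj₁ (speed trj s t 0≤s s≤t)) ⟩
    (t - s) + s                ≈⟨ //-rightDividesˡ s t ⟩
    t                          ∎

  travel⁻ : IsTrajectory X → ∀ {s t} k l → 0# ≤ s → s ≤ t →
            X s ≈ fromℕ k → X t ≈ - fromℕ l → s + fromℕ (l ℕ.+ k) ≤ t
  travel⁻ trj k l 0≤s s≤t Xs Xt =
    travel (reflect trj) k l 0≤s s≤t (-‿cong Xs) (trans (-‿cong Xt) (⁻¹-involutive _))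

  +fromℕ-trans : ∀ {r s t} k l → r + fromℕ k ≤ s → s + fromℕ l ≤ t → r + fromℕ (k ℕ.+ l) ≤ t
  +fromℕ-trans {r} {s} {t} k l h₁ h₂ = begin
    r + fromℕ (k ℕ.+ l)        ≈⟨ +-congˡ (fromℕ-+ k l) ⟩
    r + (fromℕ k + fromℕ l)    ≈⟨ +-assoc r (fromℕ k) (fromℕ l) ⟨
    (r + fromℕ k) + fromℕ l    ≤⟨ +-monoˡ-≤ (fromℕ l) h₁ ⟩
    s + fromℕ l                ≤⟨ h₂ ⟩
    t                          ∎

  α : ℝ
  α = fromℕ 393 * fromℕ 100 ⁻¹

  α-cancel-≤ : ∀ {t} k m → 0# + fromℕ k ≤ t → t ≤ α * fromℕ m → 100 ℕ.* k ℕ.≤ 393 ℕ.* m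
  α-cancel-≤ {t} k m k≤t t≤αm = ratio-cancel-≤ 393 100 {k} {m} (begin
    fromℕ k       ≈⟨ +-identityˡ (fromℕ k) ⟨
    0# + fromℕ k  ≤⟨ k≤t ⟩
    t             ≤⟨ t≤αm ⟩
    α * fromℕ m   ∎)

  Covers : (ℝ → ℝ) → ℕ → Set
  Covers X m = VisitsBy X (fromℕ m) (α * fromℕ m) × VisitsBy X (- fromℕ m) (α * fromℕ m)

  private
    -- The factor of 100 is the length 2y + x of the itinerary 0, y, -x, in the form in which adding
    -- up the legs produces it.
    x-late : ∀ x y → 100 ℕ.* ((y ℕ.+ 0) ℕ.+ (x ℕ.+ y)) ℕ.≤ 393 ℕ.* x → 200 ℕ.* y ℕ.≤ 293 ℕ.* x
    x-late x y h = ℕₚ.+-cancelʳ-≤ (100 ℕ.* x) (200 ℕ.* y) (293 ℕ.* x)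
      (≡.subst₂ ℕ._≤_ (lhs 100 x y) (ℕₚ.*-distribʳ-+ x 293 100) h)
      where
      lhs : ∀ q x y → q ℕ.* ((y ℕ.+ 0) ℕ.+ (x ℕ.+ y)) ≡ (q ℕ.+ q) ℕ.* y ℕ.+ q ℕ.* x
      lhs = solve-∀

    -- Here the itinerary is 0, -x, y, -y, of length 2x + 3y.
    y-late : ∀ x y → 100 ℕ.* (((x ℕ.+ 0) ℕ.+ (y ℕ.+ x)) ℕ.+ (y ℕ.+ y)) ℕ.≤ 393 ℕ.* y →
             200 ℕ.* x ℕ.≤ 93 ℕ.* y
    y-late x y h = ℕₚ.+-cancelʳ-≤ (300 ℕ.* y) (200 ℕ.* x) (93 ℕ.* y)
      (≡.subst₂ ℕ._≤_ (lhs 100 x y) (ℕₚ.*-distribʳ-+ y 93 300) h)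
      where
      lhs : ∀ q x y → q ℕ.* (((x ℕ.+ 0) ℕ.+ (y ℕ.+ x)) ℕ.+ (y ℕ.+ y)) ≡
                      (q ℕ.+ q) ℕ.* x ℕ.+ (q ℕ.+ q ℕ.+ q) ℕ.* y
      lhs = solve-∀

    gap-ordered : IsTrajectory X → ∀ x y {a b b′} →
                  0# ≤ a → a ≤ α * fromℕ x → X a ≈ - fromℕ x →
                  0# ≤ b → X b ≈ fromℕ y → b ≤ b′ → b′ ≤ α * fromℕ y → X b′ ≈ - fromℕ y →
                  Gap x y
    gap-ordered trj x y {a} {b} 0≤a a≤ Xa 0≤b Xb b≤b′ b′≤ Xb′ with total a b
    ... | inj₁ a≤b = inj₂ (y-late x y (α-cancel-≤ ((x ℕ.+ 0) ℕ.+ (y ℕ.+ x) ℕ.+ (y ℕ.+ y)) y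
            (+fromℕ-trans ((x ℕ.+ 0) ℕ.+ (y ℕ.+ x)) (y ℕ.+ y)
              (+fromℕ-trans (x ℕ.+ 0) (y ℕ.+ x)
                (travel⁻ trj 0 x ≤-refl 0≤a (start trj) Xa)
                (travel trj x y 0≤a a≤b Xa Xb))
              (travel⁻ trj y y 0≤b b≤b′ Xb Xb′))
            b′≤))
    ... | inj₂ b≤a = inj₁ (x-late x y (α-cancel-≤ ((y ℕ.+ 0) ℕ.+ (x ℕ.+ y)) x
            (+fromℕ-trans (y ℕ.+ 0) (x ℕ.+ y)
              (travel trj 0 y ≤-refl 0≤b (trans (start trj) (sym ε⁻¹≈ε)) Xb)
              (travel⁻ trj y x 0≤b b≤a Xb Xa))
            a≤))

  covers⇒gap : IsTrajectory X → ∀ x y → Covers X x → Covers X y → Gap x y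
  covers⇒gap trj x y ((a , 0≤a , a≤ , Xa) , (a′ , 0≤a′ , a′≤ , Xa′))
                     ((b , 0≤b , b≤ , Xb) , (b′ , 0≤b′ , b′≤ , Xb′)) with total b b′
  ... | inj₁ b≤b′ = gap-ordered trj x y 0≤a′ a′≤ Xa′ 0≤b Xb b≤b′ b′≤ Xb′
  -- When -y comes first, reflection restores the order, and the visit to x takes the role of the
  -- visit to -x.
  ... | inj₂ b′≤b = gap-ordered (reflect trj) x y 0≤a a≤ (-‿cong Xa) 0≤b′
                      (trans (-‿cong Xb′) (⁻¹-involutive _)) b′≤b b≤ (-‿cong Xb)

-- Runs obtained from the silent one by adding truthful announcements.

module SilentRun (R : Reals) {n : ℕ} (A : Search.Algorithm R n) where
  open Reals R
  open Search R
  open OrderedField R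
  open Motion R
  open Equivalence

  silent : Log n
  silent = record { announces = λ _ _ _ → ⊥ ; announces-cong = λ _ _ () }

  path-agree : ∀ {M M′ T} → AgreeBefore T M M′ →
               ∀ i t → 0# ≤ t → t ≤ T → path A M i t ≈ path A M′ i t
  path-agree agr i t 0≤t t≤T =
    causal A _ _ t 0≤t (λ l s p s<t → agr l s p (<-≤-trans s<t t≤T)) i

  AgreeBefore-sym : ∀ {M M′ : Log n} {T} → AgreeBefore T M M′ → AgreeBefore T M′ M
  AgreeBefore-sym agr i t p t<T = mk⇔ (from (agr i t p t<T)) (to (agr i t p t<T))

  module _ (x : ℝ) where

    announceFirstVisit : Robot n → Log n → Log n
    announceFirstVisit k M = record
      { announces      = λ i t p →
          announces M i t p ⊎ (i ≡ k × p ≈ x × FirstVisit (path A M k) x t)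
      ; announces-cong = λ t≈t′ p≈p′ → Sum.map (announces-cong M t≈t′ p≈p′)
          (λ (i≡k , p≈x , fv) → i≡k , trans (sym p≈p′) p≈x ,
                                FirstVisit-cong (isTrajectory A M k) t≈t′ fv)
      }

    announce-agree : ∀ {k M T} → (∀ t → t < T → ¬ FirstVisit (path A M k) x t) →
                     AgreeBefore T M (announceFirstVisit k M)
    announce-agree none i t p t<T =
      mk⇔ inj₁ [ id , (λ (_ , _ , fv) → ⊥-elim (none t t<T fv)) ]

    module _ {j k M} (follows : ∀ s → FirstVisit (path A M k) x s → ¬ ¬ VisitsBy (path A M j) x s) where

      private M′ = announceFirstVisit k M

      -- An addition before `t` would put `j` at `x` before its own first visit. So the logs agree
      -- before `t`, and by causality the path up to `t` is unchanged.
      announce-preserves : ∀ {t} → FirstVisit (path A M j) x t → FirstVisit (path A M′ j) x t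
      announce-preserves {t} fv@(_ , _ , first) = FirstVisit-agree (path-agree agr j) fv
        where
        agr : AgreeBefore t M M′
        agr = announce-agree λ s s<t fvk → follows s fvk λ (r , 0≤r , r≤s , eq) →
          first r 0≤r (≤-<-trans r≤s s<t) eq

      announce-reflects : ∀ {t} → FirstVisit (path A M′ j) x t → FirstVisit (path A M j) x t
      announce-reflects {t} fv@(_ , _ , first) =
        FirstVisit-agree (path-agree (AgreeBefore-sym {M} {M′} agr) j) fv
        where
        agr : AgreeBefore t M M′
        agr = announce-agree λ s s<t fvk@(_ , _ , firstk) →
          follows s fvk λ (r , 0≤r , r≤s , eq) →
            -- As `s` is the first visit of `k`, nothing is added before `s`, so the visit of `j` at
            -- `r` also happens under `M′`.
            let agr-s = announce-agree λ u u<s (0≤u , eqᵤ , _) → firstk u 0≤u u<s eqᵤ in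
            first r 0≤r (≤-<-trans r≤s s<t)
              (trans (sym (path-agree {M} {M′} agr-s j r 0≤r r≤s)) eq)

    module _ {j k : Robot n} (j≢k : j ≢ k) where

      private
        -- Announcing can change the later motion, so k's first visit is taken in the run
        -- that already contains the announcement of j.
        M₁ = announceFirstVisit j silent
        M₂ = announceFirstVisit k M₁

        silent-agree : ∀ {T} → ¬ VisitsBy (path A silent j) x T → AgreeBefore T silent M₁
        silent-agree none = announce-agree λ t t<T fv →
          none (VisitsBy-mono (proj₁ t<T) (FirstVisit⇒VisitsBy fv))

      -- Comparing visits by every time `T` avoids having to construct first visit times.
      Leads : Set
      Leads = ∀ T → VisitsBy (path A silent k) x T → ¬ ¬ VisitsBy (path A silent j) x T

      module _ (leads : Leads) where

        private
          self : ∀ {M i} s → FirstVisit (path A M i) x s → ¬ ¬ VisitsBy (path A M i) x s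
          self _ fv none = none (FirstVisit⇒VisitsBy fv)

          -- As long as `j` has not reached `x` under `M₁`, it has announced nothing, so `M₁` is
          -- still silent and `leads` applies.
          follows : ∀ s → FirstVisit (path A M₁ k) x s → ¬ ¬ VisitsBy (path A M₁ j) x s
          follows s fvk none₁ = leads s
            (VisitsBy-agree (path-agree (AgreeBefore-sym {silent} {M₁} agr) k) (FirstVisit⇒VisitsBy fvk))
            (λ v → none₁ (VisitsBy-agree (path-agree agr j) v))
            where
            agr : AgreeBefore s silent M₁
            agr = announce-agree λ t t<s fv → none₁
              (VisitsBy-mono (proj₁ t<s) (FirstVisit⇒VisitsBy (announce-preserves self fv)))

          sound : ∀ {i t p} → announces M₂ i t p → p ≈ x × FirstVisit (path A M₂ i) x t
          sound (inj₁ (inj₂ (≡.refl , p≈x , fv))) =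
            p≈x , announce-preserves follows (announce-preserves self fv)
          sound (inj₂ (≡.refl , p≈x , fv)) = p≈x , announce-preserves self fv

          announced : ∀ {i t p} → i ≡ j ⊎ i ≡ k → p ≈ x × FirstVisit (path A M₂ i) x t →
                      announces M₂ i t p
          announced (inj₁ ≡.refl) (p≈x , fv) =
            inj₁ (inj₂ (≡.refl , p≈x , announce-reflects self (announce-reflects follows fv)))
          announced (inj₂ ≡.refl) (p≈x , fv) = inj₂ (≡.refl , p≈x , announce-reflects self fv)

        -- All robots follow their assigned paths under `M₂`; those other than `j` and `k` merely
        -- stay silent. The log is consistent because the paths of `j` and `k` up to their first
        -- visits survive each addition.
        scenario : ∀ {f} → ¬ x ≈ 0# → (F : Subset n) → ∣ F ∣ ℕ.≤ f →
                   (∀ i → i ∉ F → i ≡ j ⊎ i ≡ k) → Scenario A f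
        scenario x≉0 F |F|≤f reliable = record
          { target    = x
          ; target≉0  = x≉0
          ; faulty    = F
          ; fewFaulty = |F|≤f
          ; position  = path A M₂
          ; moves     = isTrajectory A M₂
          ; log       = M₂
          ; located   = λ i t p a → let (p≈x , 0≤t , eq , _) = sound a in
                                    0≤t , trans p≈x (sym eq)
          ; obedient  = λ _ _ _ _ → refl
          ; truthful  = λ i i∉F t p → mk⇔ sound (announced (reliable i i∉F))
          }

        -- Until `j` visits `x`, `M₁` is silent, so a first visit of `k` under `M₁` is already a
        -- visit in the silent run.
        announced⇒visited : ∀ {i t p T} → announces M₂ i t p → t ≤ T →
                            ¬ VisitsBy (path A silent j) x T → ¬ ¬ VisitsBy (path A silent k) x T
        announced⇒visited (inj₁ (inj₂ (_ , _ , fv))) t≤T nonej _ =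
          nonej (VisitsBy-mono t≤T (FirstVisit⇒VisitsBy fv))
        announced⇒visited {t = t} (inj₂ (_ , _ , fv)) t≤T nonej nonek =
          nonek (VisitsBy-mono t≤T (VisitsBy-agree
            (path-agree (AgreeBefore-sym {silent} {M₁}
              (silent-agree {t} (nonej ∘ VisitsBy-mono t≤T))) k)
            (FirstVisit⇒VisitsBy fv)))

  -- If neither led, there would be a time with only `j` having visited and another with only `k`;
  -- the later of the two is contradictory.
  someone-leads : ∀ {x j k} (j≢k : j ≢ k) →
                  ¬ Leads x j≢k → ¬ ¬ Leads x (j≢k ∘ ≡.sym)
  someone-leads j≢k ¬jk ¬kj = ¬kj λ T vj nk → ¬jk λ T′ vk nj → case T T′ vj nk vk nj
    where
    case : ∀ {x j k} T T′ → VisitsBy (path A silent j) x T → ¬ VisitsBy (path A silent k) x T →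
           VisitsBy (path A silent k) x T′ → ¬ VisitsBy (path A silent j) x T′ → ⊥
    case T T′ vj nk vk nj with total T T′
    ... | inj₁ T≤T′ = nj (VisitsBy-mono T≤T′ vj)
    ... | inj₂ T′≤T = nk (VisitsBy-mono T′≤T vk)

  -- Whichever of `j` and `k` leads, its scenario contains an announcement by time `T`, which traces
  -- back to a visit in the silent run.
  reliable-visit : ∀ {f x T j k} → j ≢ k → ¬ x ≈ 0# → (F : Subset n) → ∣ F ∣ ℕ.≤ f →
                   (∀ i → i ∉ F → i ≡ j ⊎ i ≡ k) →
                   ((σ : Scenario A f) → target σ ≈ x → CompletedBy σ T) →
                   ¬ VisitsBy (path A silent j) x T → ¬ ¬ VisitsBy (path A silent k) x T
  reliable-visit {f} {x} {T} j≢k x≉0 F |F|≤f reliable done nj nk =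
    someone-leads j≢k (¬leads j≢k reliable nj nk)
      (¬leads (j≢k ∘ ≡.sym) (λ i i∉F → Sum.swap (reliable i i∉F)) nk nj)
    where
    ¬leads : ∀ {j k} (j≢k : j ≢ k) → (∀ i → i ∉ F → i ≡ j ⊎ i ≡ k) →
             ¬ VisitsBy (path A silent j) x T → ¬ VisitsBy (path A silent k) x T →
             ¬ Leads x j≢k
    ¬leads j≢k reliable nj nk leads
      with (i , _ , t , t≤T , a) , _ ← done (scenario x j≢k leads x≉0 F |F|≤f reliable) refl
      = announced⇒visited x j≢k leads a t≤T nj nk

-- The bound 3.93, from visitors to covered points.

lemma9 : (R : Reals) → let open Reals R in let open Search R in
    (A : Algorithm 3) → CompetitiveRatio≥ A 1 (fromℕ 393 * fromℕ 100 ⁻¹)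
lemma9 R A c bound with OrderedField._≤?_ R (Motion.α R) c
... | yes α≤c = α≤c
... | no  α≰c = ⊥-elim (Covering.impossible (λ i → Covers (path A silent i))
                          (λ i → covers⇒gap (isTrajectory A silent i)) covered)
  where
  open Reals R
  open Search R
  open OrderedField R
  open Motion R
  open SilentRun R A

  c≤α : c ≤ α
  c≤α with total c α
  ... | inj₁ h = h
  ... | inj₂ α≤c = ⊥-elim (α≰c α≤c)

  module _ (m : ℕ) .{{_ : NonZero m}} where

    d T : ℝ
    d = fromℕ m
    T = α * d

    0<d : 0# < d
    0<d = 0≤fromℕ m , fromℕ≉0 m ∘ sym

    visitor : ∀ x → ¬ x ≈ 0# → (x ≈ d ⊎ x ≈ - d) → ∀ i →
              ¬ ¬ (∃[ j ] (j ≢ i × VisitsBy (path A silent j) x T))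
    visitor x x≉0 x≈±d i none =
      -- Robot `i` is the faulty one, and `punchIn i` enumerates the other two.
      reliable-visit {T = c * d} j≢k x≉0 ⁅ i ⁆ (ℕₚ.≤-reflexive (∣⁅x⁆∣≡1 i)) reliable
        (λ σ eq → bound d 0<d σ (Sum.map (trans eq) (trans eq) x≈±d))
        (unvisited 0F) (unvisited 1F)
      where
      j≢k : punchIn i 0F ≢ punchIn i 1F
      j≢k eq with () ← punchIn-injective i 0F 1F eq
      reliable : ∀ l → l ∉ ⁅ i ⁆ → l ≡ punchIn i 0F ⊎ l ≡ punchIn i 1F
      reliable l l∉ = split (punchOut i≢l) (punchIn-punchOut i≢l)
        where
        i≢l : i ≢ l
        i≢l = x∉⁅y⁆⇒x≢y l∉ ∘ ≡.sym
        split : ∀ o → punchIn i o ≡ l → l ≡ punchIn i 0F ⊎ l ≡ punchIn i 1F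
        split 0F eq = inj₁ (≡.sym eq)
        split 1F eq = inj₂ (≡.sym eq)
      unvisited : ∀ o → ¬ VisitsBy (path A silent (punchIn i o)) x (c * d)
      unvisited o v = none (punchIn i o , punchInᵢ≢i i o ,
                            VisitsBy-mono (*-monoʳ-≤ (0≤fromℕ m) c≤α) v)

    two-visitors : ∀ x → ¬ x ≈ 0# → (x ≈ d ⊎ x ≈ - d) →
                   ¬ ¬ (∃₂ λ j k → j ≢ k × VisitsBy (path A silent j) x T
                                         × VisitsBy (path A silent k) x T)
    two-visitors x x≉0 x≈±d none =
      -- Excluding 0F is an arbitrary choice; excluding the visitor `j` so found then yields a
      -- second one.
      visitor x x≉0 x≈±d 0F λ (j , _ , vj) →
      visitor x x≉0 x≈±d j λ (k , k≢j , vk) → none (k , j , k≢j , vk , vj)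

    -- Two visitors of `d` and two of `- d` cannot be four different robots.
    covered : ¬ ¬ (∃[ i ] Covers (path A silent i) m)
    covered none =
      two-visitors d (fromℕ≉0 m) (inj₁ refl) λ (j , k , j≢k , vj , vk) →
      two-visitors (- d) (fromℕ≉0 m ∘ -x≈0⇒x≈0) (inj₂ refl) λ (j′ , k′ , j′≢k′ , vj′ , vk′) →
      no-four-distinct j≢k (distinct vj vj′) (distinct vj vk′)
                           (distinct vk vj′) (distinct vk vk′) j′≢k′
      where
      distinct : ∀ {i i′} → VisitsBy (path A silent i) d T →
                 VisitsBy (path A silent i′) (- d) T → i ≢ i′
      distinct v v′ ≡.refl = none (_ , v , v′)
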